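{- Let $G$ be a graph homomorphic to a graph $H$. Then $\mathrm{pw}(G) \leq \mathrm{pw}(H)$.
   Context: All graphs are finite, simple and undirected, and have at least one edge. A graph $G$ is homomorphic to a graph $H$ if there exists a mapping $\phi : V(G) \to V(H)$ such that $\{\phi(u),\phi(v)\} \in E(H)$ whenever $\{u,v\} \in E(G)$. Let $d$ be the Euclidean distance in the plane. A realization of a graph $G=(V,E)$ is a (not necessarily injective) function $r: V \to \mathbb{R}^2$ such that $d(r(u),r(v)) \ge 1$ for every edge $\{u,v\} \in E$. The width of a realization is the maximum of $d(r(u),r(v))$ over all $u,v \in V$. The plane-width $\mathrm{pw}(G)$ is the minimum width of all realizations of $G$. -}

module Defs where

open import Data.Bool using (if_then_else_)
open import Data.Fin using (Fin)
open import Data.Integer as ℤ using (+_; -[1+_])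
import Data.Integer.Properties as ℤ
open import Data.Nat as ℕ using (ℕ; zero; suc)
import Data.Nat.Coprimality as Coprimality
import Data.Nat.Properties as ℕ
open import Data.Product using (_×_; _,_; ∃-syntax; Σ-syntax)
open import Data.Rational as ℚ using (ℚ; 0ℚ; 1ℚ; ½; mkℚ; *≤*; *<*)
import Data.Rational.Properties as ℚ
open import Data.Rational.Unnormalised using (*≡*)
import Data.Rational.Unnormalised.Properties as ℚᵘ
open import Data.Rational.Solver using (module +-*-Solver)
open import Data.Sum using (inj₁; inj₂)
open import Data.Vec.Functional using (foldr)
open import Level using (0ℓ)
open import Algebra.Definitions.RawMonoid ℚ.+-0-rawMonoid
  using () renaming (_×_ to _·_)
open import Algebra.Properties.Monoid.Mult ℚ.+-0-monoid using (×-assocˡ)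
open import Relation.Binary using (Rel; Symmetric; Irreflexive; _=[_]⇒_)
open import Relation.Binary.PropositionalEquality
  using (_≡_; refl; sym; trans; cong; cong₂; subst; subst₂)
open import Relation.Nullary using (Dec; does; yes; no; ¬_)

private

  posHalf : ∀ {ε} → 0ℚ ℚ.< ε → 0ℚ ℚ.< ε ℚ.* ½
  posHalf 0<ε = ℚ.*-monoˡ-<-pos ½ 0<ε

  halves : ∀ ε → ε ℚ.* ½ ℚ.+ ε ℚ.* ½ ≡ ε
  halves ε = trans (sym (ℚ.*-distribˡ-+ ε ½ ½)) (ℚ.*-identityʳ ε)

  pos* : ∀ {p q} → 0ℚ ℚ.< p → 0ℚ ℚ.< q → 0ℚ ℚ.< p ℚ.* q
  pos* {p} {q} 0<p 0<q =
    subst (ℚ._< p ℚ.* q) (ℚ.*-zeroˡ q)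
      (ℚ.*-monoˡ-<-pos q {{ℚ.positive 0<q}} 0<p)

  sq-mono-≤ : ∀ {p q} → 0ℚ ℚ.≤ p → p ℚ.≤ q → p ℚ.* p ℚ.≤ q ℚ.* q
  sq-mono-≤ {p} {q} 0≤p p≤q = ℚ.≤-trans
    (ℚ.*-monoˡ-≤-nonNeg p {{ℚ.nonNegative 0≤p}} p≤q)
    (ℚ.*-monoʳ-≤-nonNeg q {{ℚ.nonNegative (ℚ.≤-trans 0≤p p≤q)}} p≤q)

  <+⇒-< : ∀ {p q ε} → p ℚ.< q ℚ.+ ε → p ℚ.- q ℚ.< ε
  <+⇒-< {p} {q} {ε} p<q+ε = subst (p ℚ.- q ℚ.<_)
    (solve 2 (λ q ε → (q :+ ε) :- q := ε) refl q ε)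
    (ℚ.+-monoˡ-< (ℚ.- q) p<q+ε)
    where open +-*-Solver

  -<⇒<+ : ∀ {p q ε} → p ℚ.- q ℚ.< ε → p ℚ.< q ℚ.+ ε
  -<⇒<+ {p} {q} {ε} p-q<ε = subst (ℚ._< q ℚ.+ ε)
    (solve 2 (λ p q → q :+ (p :- q) := p) refl p q)
    (ℚ.+-monoʳ-< q p-q<ε)
    where open +-*-Solver

  +-mono-halves : ∀ {a b c d} ε → a ℚ.< b ℚ.+ ε ℚ.* ½ → c ℚ.< d ℚ.+ ε ℚ.* ½ →
                  a ℚ.+ c ℚ.< (b ℚ.+ d) ℚ.+ ε
  +-mono-halves {a} {b} {c} {d} ε a< c< = subst (a ℚ.+ c ℚ.<_) eq (ℚ.+-mono-< a< c<)
    where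
    open +-*-Solver
    rearrange : ∀ b d e → (b ℚ.+ e) ℚ.+ (d ℚ.+ e) ≡ (b ℚ.+ d) ℚ.+ (e ℚ.+ e)
    rearrange = solve 3 (λ b d e → (b :+ e) :+ (d :+ e) := (b :+ d) :+ (e :+ e)) refl
    eq : (b ℚ.+ ε ℚ.* ½) ℚ.+ (d ℚ.+ ε ℚ.* ½) ≡ (b ℚ.+ d) ℚ.+ ε
    eq = trans (rearrange b d (ε ℚ.* ½)) (cong ((b ℚ.+ d) ℚ.+_) (halves ε))

  p≤∣p∣ : ∀ p → p ℚ.≤ ℚ.∣ p ∣
  p≤∣p∣ p with ℚ.≤-total 0ℚ p
  ... | inj₁ 0≤p = ℚ.≤-reflexive (sym (ℚ.0≤p⇒∣p∣≡p 0≤p))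
  ... | inj₂ p≤0 = ℚ.≤-trans p≤0 (ℚ.0≤∣p∣ p)

  ⊔-< : ∀ p q {r} → p ℚ.< r → q ℚ.< r → p ℚ.⊔ q ℚ.< r
  ⊔-< p q {r} p<r q<r with ℚ.⊔-sel p q
  ... | inj₁ eq = subst (ℚ._< r) (sym eq) p<r
  ... | inj₂ eq = subst (ℚ._< r) (sym eq) q<r

  -- 1 / (n + 1)
  δ : ℕ → ℚ
  δ n = mkℚ (+ 1) n (Coprimality.1-coprimeTo (suc n))

  0<δ : ∀ n → 0ℚ ℚ.< δ n
  0<δ n = ℚ.positive⁻¹ (δ n)

IsCauchy : (ℕ → ℚ) → Set
IsCauchy f = ∀ ε → 0ℚ ℚ.< ε →
  ∃[ N ] ∀ m n → N ℕ.≤ m → N ℕ.≤ n → ℚ.∣ f m ℚ.- f n ∣ ℚ.< ε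

-- Real numbers are Cauchy sequences of rationals, taken up to _≃ℝ_.
record ℝ : Set where
  constructor _,ℝ_
  field
    seq    : ℕ → ℚ
    cauchy : IsCauchy seq

open ℝ public

infix 4 _≤ℝ_ _≃ℝ_

_≤ℝ_ : Rel ℝ 0ℓ
x ≤ℝ y = ∀ ε → 0ℚ ℚ.< ε → ∃[ N ] ∀ n → N ℕ.≤ n → seq x n ℚ.≤ seq y n ℚ.+ ε

_≃ℝ_ : Rel ℝ 0ℓ
x ≃ℝ y = x ≤ℝ y × y ≤ℝ x

-- By symmetry in m and n, the absolute value in IsCauchy may be dropped.
private

  OneSided : (ℕ → ℚ) → Set
  OneSided f = ∀ ε → 0ℚ ℚ.< ε →
    ∃[ N ] ∀ m n → N ℕ.≤ m → N ℕ.≤ n → f m ℚ.< f n ℚ.+ ε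

  oneSided : ∀ x → OneSided (seq x)
  oneSided x ε 0<ε with cauchy x ε 0<ε
  ... | N , close = N , λ m n N≤m N≤n →
    -<⇒<+ (ℚ.≤-<-trans (p≤∣p∣ _) (close m n N≤m N≤n))

  fromOneSided : ∀ {f} → OneSided f → IsCauchy f
  fromOneSided {f} below ε 0<ε with below ε 0<ε
  ... | N , below-ε = N , close
    where
    close : ∀ m n → N ℕ.≤ m → N ℕ.≤ n → ℚ.∣ f m ℚ.- f n ∣ ℚ.< ε
    close m n N≤m N≤n with ℚ.∣p∣≡p∨∣p∣≡-p (f m ℚ.- f n)
    ... | inj₁ eq = subst (ℚ._< ε) (sym eq) (<+⇒-< (below-ε m n N≤m N≤n))
    ... | inj₂ eq = subst (ℚ._< ε)
      (sym (trans eq (solve 2 (λ p q → :- (p :- q) := q :- p) refl (f m) (f n))))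
      (<+⇒-< (below-ε n m N≤n N≤m))
      where open +-*-Solver

fromℚ : ℚ → ℝ
fromℚ q = (λ _ → q) ,ℝ λ ε 0<ε → 0 , λ _ _ _ _ →
  subst (λ p → ℚ.∣ p ∣ ℚ.< ε) (sym (ℚ.+-inverseʳ q)) 0<ε

0ℝ 1ℝ : ℝ
0ℝ = fromℚ 0ℚ
1ℝ = fromℚ 1ℚ

infixl 6 _+ℝ_ _-ℝ_ _⊔ℝ_
infixl 7 _*ℝ_

_+ℝ_ : ℝ → ℝ → ℝ
x +ℝ y = (λ n → seq x n ℚ.+ seq y n) ,ℝ fromOneSided below
  where
  below : OneSided (λ n → seq x n ℚ.+ seq y n)
  below ε 0<ε =
    let M , bx = oneSided x (ε ℚ.* ½) (posHalf 0<ε)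
        N , by = oneSided y (ε ℚ.* ½) (posHalf 0<ε)
    in M ℕ.⊔ N , λ m n ≤m ≤n →
      +-mono-halves {seq x m} {seq x n} {seq y m} {seq y n} ε
        (bx m n (ℕ.m⊔n≤o⇒m≤o M N ≤m) (ℕ.m⊔n≤o⇒m≤o M N ≤n))
        (by m n (ℕ.m⊔n≤o⇒n≤o M N ≤m) (ℕ.m⊔n≤o⇒n≤o M N ≤n))

-ℝ_ : ℝ → ℝ
-ℝ x = (λ n → ℚ.- seq x n) ,ℝ fromOneSided below
  where
  open +-*-Solver
  swap : ∀ a b → b ℚ.- a ≡ (ℚ.- a) ℚ.- (ℚ.- b)
  swap = solve 2 (λ a b → b :- a := (:- a) :- (:- b)) refl
  below : OneSided (λ n → ℚ.- seq x n)
  below ε 0<ε =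
    let N , bx = oneSided x ε 0<ε
    in N , λ m n ≤m ≤n → -<⇒<+ {ℚ.- seq x m} {ℚ.- seq x n} {ε}
      (subst (ℚ._< ε) (swap (seq x m) (seq x n))
        (<+⇒-< {seq x n} {seq x m} {ε} (bx n m ≤n ≤m)))

_-ℝ_ : ℝ → ℝ → ℝ
x -ℝ y = x +ℝ (-ℝ y)

_⊔ℝ_ : ℝ → ℝ → ℝ
x ⊔ℝ y = (λ n → seq x n ℚ.⊔ seq y n) ,ℝ fromOneSided below
  where
  below : OneSided (λ n → seq x n ℚ.⊔ seq y n)
  below ε 0<ε =
    let M , bx = oneSided x ε 0<ε
        N , by = oneSided y ε 0<ε
    in M ℕ.⊔ N , λ m n ≤m ≤n →
      ⊔-< (seq x m) (seq y m)
        (ℚ.<-≤-trans (bx m n (ℕ.m⊔n≤o⇒m≤o M N ≤m) (ℕ.m⊔n≤o⇒m≤o M N ≤n))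
          (ℚ.+-monoˡ-≤ ε (ℚ.p≤p⊔q (seq x n) (seq y n))))
        (ℚ.<-≤-trans (by m n (ℕ.m⊔n≤o⇒n≤o M N ≤m) (ℕ.m⊔n≤o⇒n≤o M N ≤n))
          (ℚ.+-monoˡ-≤ ε (ℚ.p≤q⊔p (seq x n) (seq y n))))

private

  bounded : ∀ x → ∃[ B ] 0ℚ ℚ.< B × (∃[ N ] ∀ n → N ℕ.≤ n → ℚ.∣ seq x n ∣ ℚ.≤ B)
  bounded x =
    let N , close = cauchy x 1ℚ (ℚ.positive⁻¹ 1ℚ)
    in ℚ.∣ seq x N ∣ ℚ.+ 1ℚ ,
       ℚ.+-mono-≤-< (ℚ.0≤∣p∣ (seq x N)) (ℚ.positive⁻¹ 1ℚ) ,
       N , λ n N≤n → subst (λ p → ℚ.∣ p ∣ ℚ.≤ ℚ.∣ seq x N ∣ ℚ.+ 1ℚ)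
         (cancel (seq x N) (seq x n))
         (ℚ.≤-trans (ℚ.∣p+q∣≤∣p∣+∣q∣ (seq x N) (seq x n ℚ.- seq x N))
           (ℚ.+-monoʳ-≤ ℚ.∣ seq x N ∣ (ℚ.<⇒≤ (close n N N≤n ℕ.≤-refl))))
    where
    open +-*-Solver
    cancel : ∀ a b → a ℚ.+ (b ℚ.- a) ≡ b
    cancel = solve 2 (λ a b → a :+ (b :- a) := b) refl

  scaled : ∀ B ε → 0ℚ ℚ.< B → 0ℚ ℚ.< ε → ∃[ η ] 0ℚ ℚ.< η × B ℚ.* η ≡ ε
  scaled B ε 0<B 0<ε =
    1/B ℚ.* ε ,
    pos* (ℚ.positive⁻¹ 1/B {{ℚ.1/pos⇒pos B}}) 0<ε ,
    trans (sym (ℚ.*-assoc B 1/B ε))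
      (trans (cong (ℚ._* ε) (ℚ.*-inverseʳ B)) (ℚ.*-identityˡ ε))
    where
    instance
      posB : ℚ.Positive B
      posB = ℚ.positive 0<B
      nonZeroB : ℚ.NonZero B
      nonZeroB = ℚ.pos⇒nonZero B
    1/B : ℚ
    1/B = ℚ.1/ B

  ∣*∣-bound : ∀ {p q B η} → 0ℚ ℚ.< B → ℚ.∣ p ∣ ℚ.≤ B → ℚ.∣ q ∣ ℚ.< η →
              ℚ.∣ p ℚ.* q ∣ ℚ.< B ℚ.* η
  ∣*∣-bound {p} {q} {B} {η} 0<B ∣p∣≤B ∣q∣<η =
    subst (ℚ._< B ℚ.* η) (sym (ℚ.∣p*q∣≡∣p∣*∣q∣ p q)) (ℚ.≤-<-trans
      (ℚ.*-monoʳ-≤-nonNeg ℚ.∣ q ∣ {{ℚ.∣-∣-nonNeg q}} ∣p∣≤B)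
      (ℚ.*-monoʳ-<-pos B {{ℚ.positive 0<B}} ∣q∣<η))

_*ℝ_ : ℝ → ℝ → ℝ
x *ℝ y = (λ n → seq x n ℚ.* seq y n) ,ℝ cauchy*
  where
  open +-*-Solver
  split : ∀ a b c d →
          a ℚ.* (c ℚ.- d) ℚ.+ d ℚ.* (a ℚ.- b) ≡ a ℚ.* c ℚ.- b ℚ.* d
  split = solve 4 (λ a b c d → a :* (c :- d) :+ d :* (a :- b) := a :* c :- b :* d) refl
  cauchy* : IsCauchy (λ n → seq x n ℚ.* seq y n)
  cauchy* ε 0<ε =
    let A , 0<A , K , x≤A = bounded x
        B , 0<B , L , y≤B = bounded y
        η , 0<η , Aη≡ = scaled A (ε ℚ.* ½) 0<A (posHalf 0<ε)
        θ , 0<θ , Bθ≡ = scaled B (ε ℚ.* ½) 0<B (posHalf 0<ε)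
        M , cy = cauchy y η 0<η
        N , cx = cauchy x θ 0<θ
    in (K ℕ.⊔ L) ℕ.⊔ (M ℕ.⊔ N) , λ m n ≤m ≤n →
      let KL≤m = ℕ.m⊔n≤o⇒m≤o (K ℕ.⊔ L) (M ℕ.⊔ N) ≤m
          KL≤n = ℕ.m⊔n≤o⇒m≤o (K ℕ.⊔ L) (M ℕ.⊔ N) ≤n
          MN≤m = ℕ.m⊔n≤o⇒n≤o (K ℕ.⊔ L) (M ℕ.⊔ N) ≤m
          MN≤n = ℕ.m⊔n≤o⇒n≤o (K ℕ.⊔ L) (M ℕ.⊔ N) ≤n
          p = seq x m ℚ.* (seq y m ℚ.- seq y n)
          q = seq y n ℚ.* (seq x m ℚ.- seq x n)
      in subst (λ r → ℚ.∣ r ∣ ℚ.< ε)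
        (split (seq x m) (seq x n) (seq y m) (seq y n))
        (ℚ.≤-<-trans (ℚ.∣p+q∣≤∣p∣+∣q∣ p q)
          (subst (ℚ.∣ p ∣ ℚ.+ ℚ.∣ q ∣ ℚ.<_) (trans (cong₂ ℚ._+_ Aη≡ Bθ≡) (halves ε))
            (ℚ.+-mono-<
              (∣*∣-bound {seq x m} {seq y m ℚ.- seq y n} 0<A
                (x≤A m (ℕ.m⊔n≤o⇒m≤o K L KL≤m))
                (cy m n (ℕ.m⊔n≤o⇒m≤o M N MN≤m) (ℕ.m⊔n≤o⇒m≤o M N MN≤n)))
              (∣*∣-bound {seq y n} {seq x m ℚ.- seq x n} 0<B
                (y≤B n (ℕ.m⊔n≤o⇒n≤o K L KL≤n))
                (cx m n (ℕ.m⊔n≤o⇒n≤o M N MN≤m) (ℕ.m⊔n≤o⇒n≤o M N MN≤n))))))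

-- Square roots.  The n-th approximant to √ x is the largest multiple of
-- 1 / (n + 1) whose square is at most the n-th approximant to x, the latter
-- being cut off at 0 (so that √ x = 0 when x ≤ 0).

private

  -- The largest multiple i · d with i ≤ k whose square is at most q.
  root≤ : ℕ → ℚ → ℚ → ℚ
  root≤ zero    d q = 0ℚ
  root≤ (suc k) d q =
    if does ((suc k · d) ℚ.* (suc k · d) ℚ.≤? q) then suc k · d else root≤ k d q

  0≤· : ∀ k {d} → 0ℚ ℚ.≤ d → 0ℚ ℚ.≤ k · d
  0≤· zero    0≤d = ℚ.≤-refl
  0≤· (suc k) 0≤d = ℚ.+-mono-≤ 0≤d (0≤· k 0≤d)

  if-elim : ∀ {P : Set} {a b} (Q : ℚ → Set) (P? : Dec P) →
            (P → Q a) → (¬ P → Q b) → Q (if does P? then a else b)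
  if-elim Q (yes p) qa qb = qa p
  if-elim Q (no ¬p) qa qb = qb ¬p

  0≤root≤ : ∀ k d q → 0ℚ ℚ.≤ d → 0ℚ ℚ.≤ root≤ k d q
  0≤root≤ zero    d q 0≤d = ℚ.≤-refl
  0≤root≤ (suc k) d q 0≤d =
    if-elim (0ℚ ℚ.≤_) ((suc k · d) ℚ.* (suc k · d) ℚ.≤? q)
      (λ _ → 0≤· (suc k) 0≤d) (λ _ → 0≤root≤ k d q 0≤d)

  root≤-lower : ∀ k d q → 0ℚ ℚ.≤ q → root≤ k d q ℚ.* root≤ k d q ℚ.≤ q
  root≤-lower zero    d q 0≤q = 0≤q
  root≤-lower (suc k) d q 0≤q =
    if-elim (λ s → s ℚ.* s ℚ.≤ q) ((suc k · d) ℚ.* (suc k · d) ℚ.≤? q)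
      (λ ≤q → ≤q) (λ _ → root≤-lower k d q 0≤q)

  root≤-upper : ∀ k d q → q ℚ.< (suc k · d) ℚ.* (suc k · d) →
                q ℚ.< (d ℚ.+ root≤ k d q) ℚ.* (d ℚ.+ root≤ k d q)
  root≤-upper zero    d q q< = q<
  root≤-upper (suc k) d q q< =
    if-elim (λ s → q ℚ.< (d ℚ.+ s) ℚ.* (d ℚ.+ s)) ((suc k · d) ℚ.* (suc k · d) ℚ.≤? q)
      (λ _ → q<) (λ ≰q → root≤-upper k d q (ℚ.≰⇒> ≰q))

  ·≡* : ∀ k d → k · d ≡ (k · 1ℚ) ℚ.* d
  ·≡* zero    d = sym (ℚ.*-zeroˡ d)
  ·≡* (suc k) d = trans (cong₂ ℚ._+_ (sym (ℚ.*-identityˡ d)) (·≡* k d))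
    (sym (ℚ.*-distribʳ-+ d 1ℚ (k · 1ℚ)))

  natℚ : ℕ → ℚ
  natℚ k = mkℚ (+ k) 0 (Coprimality.sym (Coprimality.1-coprimeTo k))

  natℚ-suc : ∀ k → 1ℚ ℚ.+ natℚ k ≡ natℚ (suc k)
  natℚ-suc k = ℚ.toℚᵘ-injective (ℚᵘ.≃-trans (ℚ.toℚᵘ-homo-+ 1ℚ (natℚ k))
    (*≡* (cong (λ i → (+ 1 ℤ.+ i) ℤ.* + 1) (ℤ.*-identityʳ (+ k)))))

  ·1≡natℚ : ∀ k → k · 1ℚ ≡ natℚ k
  ·1≡natℚ zero    = refl
  ·1≡natℚ (suc k) = trans (cong (1ℚ ℚ.+_) (·1≡natℚ k)) (natℚ-suc k)

  suc·δ≡1 : ∀ n → suc n · δ n ≡ 1ℚ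
  suc·δ≡1 n = trans (·≡* (suc n) (δ n))
    (trans (cong (ℚ._* δ n) (·1≡natℚ (suc n))) (ℚ.*-inverseʳ (natℚ (suc n))))

  q≤∣↥q∣ : ∀ q → q ℚ.≤ natℚ ℤ.∣ ℚ.↥ q ∣
  q≤∣↥q∣ (mkℚ (+ a)      d _) = *≤* (subst₂ ℤ._≤_ (ℤ.pos-* a 1) (ℤ.pos-* a (suc d))
    (ℤ.+≤+ (ℕ.*-monoʳ-≤ a (ℕ.s≤s ℕ.z≤n))))
  q≤∣↥q∣ (mkℚ -[1+ a ] d _) = *≤* ℤ.-≤+

  -- (∣ ↥ q ∣ + 1) · (n + 1) steps of size 1 / (n + 1) lead beyond √ q.
  steps : ℕ → ℚ → ℕ
  steps n q = suc ℤ.∣ ℚ.↥ q ∣ ℕ.* suc n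

  rootApprox : ℕ → ℚ → ℚ
  rootApprox n q = root≤ (steps n q) (δ n) q

  0≤rootApprox : ∀ n q → 0ℚ ℚ.≤ rootApprox n q
  0≤rootApprox n q = 0≤root≤ (steps n q) (δ n) q (ℚ.<⇒≤ (0<δ n))

  rootApprox-lower : ∀ n q → 0ℚ ℚ.≤ q → rootApprox n q ℚ.* rootApprox n q ℚ.≤ q
  rootApprox-lower n q = root≤-lower (steps n q) (δ n) q

  rootApprox-upper : ∀ n q → let s = rootApprox n q in
                     q ℚ.< (δ n ℚ.+ s) ℚ.* (δ n ℚ.+ s)
  rootApprox-upper n q = root≤-upper k (δ n) q
    (ℚ.≤-<-trans (q≤∣↥q∣ q) (ℚ.<-≤-trans c<1+c (ℚ.≤-trans 1+c≤sq
      (sq-mono-≤ 0≤1+c 1+c≤))))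
    where
    k = steps n q
    c = ℤ.∣ ℚ.↥ q ∣
    0≤1+c : 0ℚ ℚ.≤ natℚ (suc c)
    0≤1+c = ℚ.nonNegative⁻¹ (natℚ (suc c))
    c<1+c : natℚ c ℚ.< natℚ (suc c)
    c<1+c = subst₂ ℚ._<_ (ℚ.+-identityˡ (natℚ c)) (natℚ-suc c)
      (ℚ.+-monoˡ-< (natℚ c) (ℚ.positive⁻¹ 1ℚ))
    1≤1+c : 1ℚ ℚ.≤ natℚ (suc c)
    1≤1+c = subst₂ ℚ._≤_ (ℚ.+-identityʳ 1ℚ) (natℚ-suc c)
      (ℚ.+-monoʳ-≤ 1ℚ (ℚ.nonNegative⁻¹ (natℚ c)))
    1+c≤sq : natℚ (suc c) ℚ.≤ natℚ (suc c) ℚ.* natℚ (suc c)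
    1+c≤sq = subst (ℚ._≤ natℚ (suc c) ℚ.* natℚ (suc c)) (ℚ.*-identityˡ (natℚ (suc c)))
      (ℚ.*-monoʳ-≤-nonNeg (natℚ (suc c)) 1≤1+c)
    k·δ≡ : k · δ n ≡ natℚ (suc c)
    k·δ≡ = trans (sym (×-assocˡ (δ n) (suc c) (suc n)))
      (trans (cong (suc c ·_) (suc·δ≡1 n)) (·1≡natℚ (suc c)))
    1+c≤ : natℚ (suc c) ℚ.≤ suc k · δ n
    1+c≤ = subst₂ ℚ._≤_ (ℚ.+-identityˡ (natℚ (suc c))) (cong (δ n ℚ.+_) (sym k·δ≡))
      (ℚ.+-monoˡ-≤ (natℚ (suc c)) (ℚ.<⇒≤ (0<δ n)))

  archimedean : ∀ ε → 0ℚ ℚ.< ε → ∃[ N ] ∀ n → N ℕ.≤ n → δ n ℚ.< ε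
  archimedean ε@(mkℚ (+ zero)   _ _) 0<ε with ℚ.positive 0<ε
  ... | ()
  archimedean ε@(mkℚ -[1+ _ ]   _ _) 0<ε with ℚ.positive 0<ε
  ... | ()
  archimedean ε@(mkℚ (+ suc p) d _) 0<ε = suc d , λ n d<n →
    *<* (subst₂ ℤ._<_ (ℤ.pos-* 1 (suc d)) (ℤ.pos-* (suc p) (suc n))
      (ℤ.+<+ (ℕ.<-≤-trans
        (subst (ℕ._< suc n) (sym (ℕ.*-identityˡ (suc d))) (ℕ.s≤s d<n))
        (ℕ.m≤m+n (suc n) (p ℕ.* suc n)))))

  root-step : ∀ {a b s t d η} → 0ℚ ℚ.≤ t → 0ℚ ℚ.< d → d ℚ.< η →
              s ℚ.* s ℚ.≤ a → b ℚ.< (d ℚ.+ t) ℚ.* (d ℚ.+ t) →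
              a ℚ.< b ℚ.+ η ℚ.* η → s ℚ.< t ℚ.+ (η ℚ.+ η)
  root-step {a} {b} {s} {t} {d} {η} 0≤t 0<d d<η s²≤a b< a< = ℚ.≰⇒> λ t+2η≤s →
    ℚ.<-irrefl refl
      (ℚ.<-≤-trans (ℚ.<-≤-trans a< (ℚ.+-monoˡ-≤ (η ℚ.* η)
        (ℚ.≤-trans (ℚ.<⇒≤ b<) (sq-mono-≤ 0≤d+t (ℚ.+-monoˡ-≤ t (ℚ.<⇒≤ d<η))))))
      (ℚ.≤-trans expand (ℚ.≤-trans (sq-mono-≤ 0≤t+2η t+2η≤s) s²≤a)))
    where
    open +-*-Solver
    0≤η : 0ℚ ℚ.≤ η
    0≤η = ℚ.<⇒≤ (ℚ.<-trans 0<d d<η)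
    0≤d+t : 0ℚ ℚ.≤ d ℚ.+ t
    0≤d+t = ℚ.+-mono-≤ (ℚ.<⇒≤ 0<d) 0≤t
    0≤η+t : 0ℚ ℚ.≤ η ℚ.+ t
    0≤η+t = ℚ.+-mono-≤ 0≤η 0≤t
    0≤t+2η : 0ℚ ℚ.≤ t ℚ.+ (η ℚ.+ η)
    0≤t+2η = ℚ.+-mono-≤ 0≤t (ℚ.+-mono-≤ 0≤η 0≤η)
    0≤cross : 0ℚ ℚ.≤ η ℚ.* (η ℚ.+ t)
    0≤cross = subst (ℚ._≤ η ℚ.* (η ℚ.+ t)) (ℚ.*-zeroʳ η)
      (ℚ.*-monoˡ-≤-nonNeg η {{ℚ.nonNegative 0≤η}} 0≤η+t)
    square : ∀ t η → ((η ℚ.+ t) ℚ.* (η ℚ.+ t) ℚ.+ η ℚ.* η)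
                       ℚ.+ (η ℚ.* (η ℚ.+ t) ℚ.+ η ℚ.* (η ℚ.+ t))
                     ≡ (t ℚ.+ (η ℚ.+ η)) ℚ.* (t ℚ.+ (η ℚ.+ η))
    square = solve 2 (λ t η →
      ((η :+ t) :* (η :+ t) :+ η :* η) :+ (η :* (η :+ t) :+ η :* (η :+ t))
      := (t :+ (η :+ η)) :* (t :+ (η :+ η))) refl
    expand : (η ℚ.+ t) ℚ.* (η ℚ.+ t) ℚ.+ η ℚ.* η ℚ.≤
             (t ℚ.+ (η ℚ.+ η)) ℚ.* (t ℚ.+ (η ℚ.+ η))
    expand = subst₂ ℚ._≤_ (ℚ.+-identityʳ _) (square t η)
      (ℚ.+-monoʳ-≤ ((η ℚ.+ t) ℚ.* (η ℚ.+ t) ℚ.+ η ℚ.* η)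
        (ℚ.+-mono-≤ 0≤cross 0≤cross))

√_ : ℝ → ℝ
√ x = root ,ℝ fromOneSided below
  where
  cut : ℕ → ℚ
  cut n = seq x n ℚ.⊔ 0ℚ
  0≤cut : ∀ n → 0ℚ ℚ.≤ cut n
  0≤cut n = ℚ.p≤q⊔p (seq x n) 0ℚ
  root : ℕ → ℚ
  root n = rootApprox n (cut n)
  below : OneSided root
  below ε 0<ε =
    let η   = ε ℚ.* ½
        0<η = posHalf 0<ε
        M , bx = oneSided x (η ℚ.* η) (pos* 0<η 0<η)
        N , δ< = archimedean η 0<η
    in M ℕ.⊔ N , λ m n ≤m ≤n →
      subst (λ e → root m ℚ.< root n ℚ.+ e) (halves ε)
        (root-step {cut m} {cut n} {root m} {root n} {δ n} {η}
          (0≤rootApprox n (cut n))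
          (0<δ n)
          (δ< n (ℕ.m⊔n≤o⇒n≤o M N ≤n))
          (rootApprox-lower m (cut m) (0≤cut m))
          (rootApprox-upper n (cut n))
          (⊔-< (seq x m) 0ℚ
            (ℚ.<-≤-trans (bx m n (ℕ.m⊔n≤o⇒m≤o M N ≤m) (ℕ.m⊔n≤o⇒m≤o M N ≤n))
              (ℚ.+-monoˡ-≤ (η ℚ.* η) (ℚ.p≤p⊔q (seq x n) 0ℚ)))
            (ℚ.+-mono-≤-< (0≤cut n) (pos* 0<η 0<η))))

ℝ² : Set
ℝ² = ℝ × ℝ

d : ℝ² → ℝ² → ℝ
d (x₁ , y₁) (x₂ , y₂) =
  √ ((x₁ -ℝ x₂) *ℝ (x₁ -ℝ x₂) +ℝ (y₁ -ℝ y₂) *ℝ (y₁ -ℝ y₂))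

record Graph : Set₁ where
  field
    order   : ℕ
    Adj     : Rel (Fin order) 0ℓ
    adj-sym : Symmetric Adj
    simple  : Irreflexive _≡_ Adj
    edge    : ∃[ u ] ∃[ v ] Adj u v

  V : Set
  V = Fin order

open Graph public using (V; Adj)

HomomorphicTo : Graph → Graph → Set
HomomorphicTo G H = Σ[ φ ∈ (V G → V H) ] (Adj G =[ φ ]⇒ Adj H)

record Realization (G : Graph) : Set where
  field
    pos       : V G → ℝ²
    separated : ∀ {u v} → Adj G u v → 1ℝ ≤ℝ d (pos u) (pos v)

open Realization public

-- Since V G is inhabited and d (pos r u) (pos r u) is zero, starting the
-- folds at 0ℝ does not affect the maximum.
width : ∀ {G} → Realization G → ℝ
width r = foldr _⊔ℝ_ 0ℝ λ u → foldr _⊔ℝ_ 0ℝ λ v → d (pos r u) (pos r v)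

-- p is the least width of a realization of G, that is, pw(G) = p.  (Real
-- numbers being represented by sequences, pw(G) is unique up to _≃ℝ_.)
IsPlaneWidth : Graph → ℝ → Set
IsPlaneWidth G p = (Σ[ r ∈ Realization G ] width r ≃ℝ p)
                 × (∀ (r : Realization G) → p ≤ℝ width r)

{-# OPTIONS --safe #-}
module Submission where

-- Let φ be a homomorphism from G to H.  If r is a realization of H, then
-- r ∘ φ is a realization of G, since φ carries edges to edges
-- (`pullback`).  The distances occurring in r ∘ φ all occur in r, so its
-- width is at most that of r (`width-pullback`).  Taking for r a
-- realization of H of minimum width gives
--   pw(G) ≤ width (r ∘ φ) ≤ width r = pw(H).

open import Defs

open import Data.Fin using (zero; suc)
import Data.Nat as ℕ
import Data.Nat.Properties as ℕ
open import Data.Product using (_,_)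
open import Data.Rational as ℚ using (0ℚ; ½)
import Data.Rational.Properties as ℚ
open import Data.Vec.Functional using (Vector; foldr; head; tail)
open import Function using (_∘_)
open import Relation.Binary.PropositionalEquality
  using (_≡_; sym; trans; cong; subst)

-- Sequences that compare termwise represent reals that compare.
termwise⇒≤ℝ : ∀ x y → (∀ n → seq x n ℚ.≤ seq y n) → x ≤ℝ y
termwise⇒≤ℝ x y x≤y ε 0<ε = 0 , λ n _ →
  subst (ℚ._≤ seq y n ℚ.+ ε) (ℚ.+-identityʳ (seq x n))
    (ℚ.+-mono-≤ (x≤y n) (ℚ.<⇒≤ 0<ε))

≤ℝ-refl : ∀ x → x ≤ℝ x
≤ℝ-refl x = termwise⇒≤ℝ x x λ _ → ℚ.≤-refl

≤ℝ-trans : ∀ x y z → x ≤ℝ y → y ≤ℝ z → x ≤ℝ z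
≤ℝ-trans x y z x≤y y≤z ε 0<ε =
  let M , x≤y+ = x≤y (ε ℚ.* ½) 0<ε/2
      N , y≤z+ = y≤z (ε ℚ.* ½) 0<ε/2
  in M ℕ.⊔ N , λ n ≤n →
    subst (seq x n ℚ.≤_) (regroup (seq z n))
      (ℚ.≤-trans (x≤y+ n (ℕ.m⊔n≤o⇒m≤o M N ≤n))
        (ℚ.+-monoˡ-≤ (ε ℚ.* ½) (y≤z+ n (ℕ.m⊔n≤o⇒n≤o M N ≤n))))
  where
  0<ε/2 : 0ℚ ℚ.< ε ℚ.* ½
  0<ε/2 = ℚ.*-monoˡ-<-pos ½ 0<ε
  regroup : ∀ c → (c ℚ.+ ε ℚ.* ½) ℚ.+ ε ℚ.* ½ ≡ c ℚ.+ ε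
  regroup c = trans (ℚ.+-assoc c (ε ℚ.* ½) (ε ℚ.* ½))
    (cong (c ℚ.+_) (trans (sym (ℚ.*-distribˡ-+ ε ½ ½)) (ℚ.*-identityʳ ε)))

x≤ℝx⊔y : ∀ x y → x ≤ℝ x ⊔ℝ y
x≤ℝx⊔y x y = termwise⇒≤ℝ x (x ⊔ℝ y) λ n → ℚ.p≤p⊔q (seq x n) (seq y n)

y≤ℝx⊔y : ∀ x y → y ≤ℝ x ⊔ℝ y
y≤ℝx⊔y x y = termwise⇒≤ℝ y (x ⊔ℝ y) λ n → ℚ.p≤q⊔p (seq x n) (seq y n)

⊔ℝ-lub : ∀ x y z → x ≤ℝ z → y ≤ℝ z → x ⊔ℝ y ≤ℝ z
⊔ℝ-lub x y z x≤z y≤z ε 0<ε =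
  let M , x≤z+ = x≤z ε 0<ε
      N , y≤z+ = y≤z ε 0<ε
  in M ℕ.⊔ N , λ n ≤n →
    ℚ.⊔-lub (x≤z+ n (ℕ.m⊔n≤o⇒m≤o M N ≤n)) (y≤z+ n (ℕ.m⊔n≤o⇒n≤o M N ≤n))

-- The maximum of 0 and the entries of a finite family of reals; for a
-- nonempty family of distances it is the plain maximum.
max⁰ : ∀ {n} → Vector ℝ n → ℝ
max⁰ = foldr _⊔ℝ_ 0ℝ

0≤max⁰ : ∀ {n} (xs : Vector ℝ n) → 0ℝ ≤ℝ max⁰ xs
0≤max⁰ {ℕ.zero}  xs = ≤ℝ-refl 0ℝ
0≤max⁰ {ℕ.suc n} xs = ≤ℝ-trans 0ℝ (max⁰ (tail xs)) (max⁰ xs)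
  (0≤max⁰ (tail xs)) (y≤ℝx⊔y (head xs) (max⁰ (tail xs)))

entry≤max⁰ : ∀ {n} (xs : Vector ℝ n) i → xs i ≤ℝ max⁰ xs
entry≤max⁰ xs zero    = x≤ℝx⊔y (head xs) (max⁰ (tail xs))
entry≤max⁰ xs (suc i) = ≤ℝ-trans (xs (suc i)) (max⁰ (tail xs)) (max⁰ xs)
  (entry≤max⁰ (tail xs) i) (y≤ℝx⊔y (head xs) (max⁰ (tail xs)))

max⁰-lub : ∀ {n} (xs : Vector ℝ n) z →
           0ℝ ≤ℝ z → (∀ i → xs i ≤ℝ z) → max⁰ xs ≤ℝ z
max⁰-lub {ℕ.zero}  xs z 0≤z xs≤z = 0≤z
max⁰-lub {ℕ.suc n} xs z 0≤z xs≤z = ⊔ℝ-lub (head xs) (max⁰ (tail xs)) z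
  (xs≤z zero) (max⁰-lub (tail xs) z 0≤z (xs≤z ∘ suc))

module _ {G : Graph} (r : Realization G) where

  -- The distances from u to all vertices.
  private
    distances : V G → Vector ℝ (Graph.order G)
    distances u v = d (pos r u) (pos r v)

  0≤width : 0ℝ ≤ℝ width r
  0≤width = 0≤max⁰ (max⁰ ∘ distances)

  distance≤width : ∀ u v → d (pos r u) (pos r v) ≤ℝ width r
  distance≤width u v = ≤ℝ-trans (distances u v) (max⁰ (distances u)) (width r)
    (entry≤max⁰ (distances u) v) (entry≤max⁰ (max⁰ ∘ distances) u)

  width-lub : ∀ z → 0ℝ ≤ℝ z → (∀ u v → d (pos r u) (pos r v) ≤ℝ z) →
              width r ≤ℝ z
  width-lub z 0≤z d≤z = max⁰-lub (max⁰ ∘ distances) z 0≤z λ u →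
    max⁰-lub (distances u) z 0≤z (d≤z u)

-- The realization r ∘ φ of G induced by a homomorphism φ from G to H and a
-- realization r of H.
pullback : ∀ {G H} → HomomorphicTo G H → Realization H → Realization G
pullback (φ , φ-hom) r = record
  { pos       = pos r ∘ φ
  ; separated = λ uv → separated r (φ-hom uv)
  }

width-pullback : ∀ {G H} (h : HomomorphicTo G H) (r : Realization H) →
                 width (pullback {G} {H} h r) ≤ℝ width r
width-pullback {G} {H} h@(φ , _) r =
  width-lub (pullback {G} {H} h r) (width r) (0≤width r)
    λ u v → distance≤width r (φ u) (φ v)

theorem5p1 : (G H : Graph) → HomomorphicTo G H →
    (p q : ℝ) → IsPlaneWidth G p → IsPlaneWidth H q → p ≤ℝ q
theorem5p1 G H h p q (_ , p-least) ((r , width≤q , _) , _) =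
  ≤ℝ-trans p (width r∘φ) q (p-least r∘φ)
    (≤ℝ-trans (width r∘φ) (width r) q (width-pullback {G} {H} h r) width≤q)
  where
  r∘φ : Realization G
  r∘φ = pullback {G} {H} h r
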